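{- Let $C$ be a category with $C(x,y)$ finite for all objects $x,y$. Then $C$ is an essentially finite decomposition category if and only if $C$ is an isocyclic essentially locally finite category.
   Context: Two morphisms $f:x\to y$, $g:z\to w$ are isomorphic if there are isomorphisms $\alpha:x\to z$, $\beta:y\to w$ with $g\alpha=\beta f$; $\overline{f}$ is the class of $f$ and $\overline{C}_1$ the set of classes. For $n\ge1$, an $n$-decomposition of $\overline{f}$ is a tuple $(f_1,\dots,f_n)$ of composable morphisms such that $f_n\cdots f_1=\beta^{ -1}f\alpha$ for some isomorphisms $\alpha,\beta$; $\mathrm{D}_n\overline{f}$ is the groupoid of these, with morphisms families of vertical isomorphisms $x_i\to z_i$ making all squares commute. For $n\ge2$, $\mathrm{PD}_n\overline{f}$ is the full subgroupoid of decompositions with no $f_i$ an isomorphism; $\mathrm{PD}_1\overline{f}=\mathrm{D}_1\overline{f}$; $\mathrm{PD}\overline{f}=\bigsqcup_n\mathrm{PD}_n\overline{f}$. $C$ is an essentially finite decomposition category if the set $\overline{\mathrm{PD}}\overline{f}$ of isomorphism classes of objects of $\mathrm{PD}\overline{f}$ is finite for every $\overline{f}$. $C$ is isocyclic if in any diagram $x\to y\to x$ both morphisms are isomorphisms; it is essentially locally finite if all hom-sets are finite, $x\to y\to x$ forces $x\cong y$, and $\{\overline{z}:\exists\ x\to z\to y\}$ (isomorphism classes of objects) is finite for all $x,y$. -}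

module Defs where

open import Level using (Level; _⊔_) renaming (suc to lsuc)
open import Data.Nat.Base as ℕ using (ℕ)
open import Data.Fin.Base using (Fin; zero; suc; inject₁; fromℕ)
open import Data.Product.Base using (Σ; ∃; _×_; _,_; proj₁; proj₂)
open import Function.Base using (_∘′_)
open import Function.Bundles using (Inverse)
open import Relation.Binary.Bundles using (Setoid)
open import Relation.Binary.Structures using (IsEquivalence)
import Relation.Binary.Construct.On as On
import Relation.Binary.PropositionalEquality as ≡
import Relation.Binary.Reasoning.Setoid as SetoidReasoning
open import Relation.Nullary.Negation.Core using (¬_)

private
  variable
    a o ℓ e p : Level

-- A setoid is finite when its set of equivalence classes is in bijection with
-- some Fin n.
Finite : Setoid a ℓ → Set (a ⊔ ℓ)
Finite S = ∃ λ n → Inverse (≡.setoid (Fin n)) S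

-- Categories have hom-setoids; no equality of objects is assumed.
record Category (o ℓ e : Level) : Set (lsuc (o ⊔ ℓ ⊔ e)) where
  infix  4 _≈_ _⇒_
  infixr 9 _∘_
  field
    Obj : Set o
    _⇒_ : Obj → Obj → Set ℓ
    _≈_ : ∀ {x y} → x ⇒ y → x ⇒ y → Set e
    id  : ∀ {x} → x ⇒ x
    _∘_ : ∀ {x y z} → y ⇒ z → x ⇒ y → x ⇒ z

    equiv     : ∀ {x y} → IsEquivalence (_≈_ {x} {y})
    assoc     : ∀ {w x y z} (f : w ⇒ x) (g : x ⇒ y) (h : y ⇒ z) →
                (h ∘ g) ∘ f ≈ h ∘ (g ∘ f)
    identityˡ : ∀ {x y} (f : x ⇒ y) → id ∘ f ≈ f
    identityʳ : ∀ {x y} (f : x ⇒ y) → f ∘ id ≈ f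
    ∘-resp-≈  : ∀ {x y z} {f f′ : y ⇒ z} {g g′ : x ⇒ y} →
                f ≈ f′ → g ≈ g′ → f ∘ g ≈ f′ ∘ g′

  module Equiv {x y : Obj} = IsEquivalence (equiv {x} {y})

  Hom : Obj → Obj → Setoid ℓ e
  Hom x y = record { Carrier = x ⇒ y ; _≈_ = _≈_ ; isEquivalence = equiv }

  record IsIso {x y : Obj} (f : x ⇒ y) : Set (ℓ ⊔ e) where
    field
      inv  : y ⇒ x
      isoˡ : inv ∘ f ≈ id
      isoʳ : f ∘ inv ≈ id

  infix 4 _≅_
  record _≅_ (x y : Obj) : Set (ℓ ⊔ e) where
    field
      to    : x ⇒ y
      isIso : IsIso to
    open IsIso isIso public renaming (inv to from)

  cancelMiddle : ∀ {w x y z} {f : w ⇒ x} {g : x ⇒ y} {h : y ⇒ x} {k : x ⇒ z} →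
                 h ∘ g ≈ id → (k ∘ h) ∘ (g ∘ f) ≈ k ∘ f
  cancelMiddle {w} {z = z} {f} {g} {h} {k} hg = begin
    (k ∘ h) ∘ (g ∘ f)  ≈⟨ assoc (g ∘ f) h k ⟩
    k ∘ (h ∘ (g ∘ f))  ≈⟨ ∘-resp-≈ Equiv.refl (assoc f g h) ⟨
    k ∘ ((h ∘ g) ∘ f)  ≈⟨ ∘-resp-≈ Equiv.refl (∘-resp-≈ hg Equiv.refl) ⟩
    k ∘ (id ∘ f)       ≈⟨ ∘-resp-≈ Equiv.refl (identityˡ f) ⟩
    k ∘ f              ∎
    where open SetoidReasoning (Hom w z)

  ≅-refl : ∀ {x} → x ≅ x
  ≅-refl = record
    { to    = id
    ; isIso = record { inv = id ; isoˡ = identityˡ id ; isoʳ = identityˡ id }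
    }

  ≅-sym : ∀ {x y} → x ≅ y → y ≅ x
  ≅-sym α = record
    { to    = from
    ; isIso = record { inv = to ; isoˡ = isoʳ ; isoʳ = isoˡ }
    }
    where open _≅_ α

  ≅-trans : ∀ {x y z} → x ≅ y → y ≅ z → x ≅ z
  ≅-trans α β = record
    { to    = β.to ∘ α.to
    ; isIso = record
      { inv  = α.from ∘ β.from
      ; isoˡ = Equiv.trans (cancelMiddle β.isoˡ) α.isoˡ
      ; isoʳ = Equiv.trans (cancelMiddle α.isoʳ) β.isoʳ
      }
    }
    where
    module α = _≅_ α
    module β = _≅_ β

  -- If h α = β f with α and β isomorphisms, then f α⁻¹ = β⁻¹ h.
  square-sym : ∀ {x y z w} {f : x ⇒ y} {h : z ⇒ w} (α : x ≅ z) (β : y ≅ w) →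
               h ∘ _≅_.to α ≈ _≅_.to β ∘ f →
               f ∘ _≅_.from α ≈ _≅_.from β ∘ h
  square-sym {y = y} {z = z} {f = f} {h = h} α β sq = begin
    f ∘ α.from                          ≈⟨ identityˡ _ ⟨
    id ∘ (f ∘ α.from)                   ≈⟨ ∘-resp-≈ β.isoˡ Equiv.refl ⟨
    (β.from ∘ β.to) ∘ (f ∘ α.from)      ≈⟨ assoc _ _ _ ⟩
    β.from ∘ (β.to ∘ (f ∘ α.from))      ≈⟨ ∘-resp-≈ Equiv.refl (assoc _ _ _) ⟨
    β.from ∘ ((β.to ∘ f) ∘ α.from)      ≈⟨ ∘-resp-≈ Equiv.refl (∘-resp-≈ sq Equiv.refl) ⟨
    β.from ∘ ((h ∘ α.to) ∘ α.from)      ≈⟨ ∘-resp-≈ Equiv.refl (assoc _ _ _) ⟩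
    β.from ∘ (h ∘ (α.to ∘ α.from))      ≈⟨ ∘-resp-≈ Equiv.refl (∘-resp-≈ Equiv.refl α.isoʳ) ⟩
    β.from ∘ (h ∘ id)                   ≈⟨ ∘-resp-≈ Equiv.refl (identityʳ h) ⟩
    β.from ∘ h                          ∎
    where
    open SetoidReasoning (Hom z y)
    module α = _≅_ α
    module β = _≅_ β

  square-trans : ∀ {x y x′ y′ x″ y″} {f : x ⇒ y} {g : x′ ⇒ y′} {h : x″ ⇒ y″}
                 {α : x ⇒ x′} {β : y ⇒ y′} {α′ : x′ ⇒ x″} {β′ : y′ ⇒ y″} →
                 g ∘ α ≈ β ∘ f → h ∘ α′ ≈ β′ ∘ g →
                 h ∘ (α′ ∘ α) ≈ (β′ ∘ β) ∘ f
  square-trans {x} {y″ = y″} {f} {g} {h} {α} {β} {α′} {β′} p q = begin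
    h ∘ (α′ ∘ α)   ≈⟨ assoc _ _ _ ⟨
    (h ∘ α′) ∘ α   ≈⟨ ∘-resp-≈ q Equiv.refl ⟩
    (β′ ∘ g) ∘ α   ≈⟨ assoc _ _ _ ⟩
    β′ ∘ (g ∘ α)   ≈⟨ ∘-resp-≈ Equiv.refl p ⟩
    β′ ∘ (β ∘ f)   ≈⟨ assoc _ _ _ ⟨
    (β′ ∘ β) ∘ f   ∎
    where open SetoidReasoning (Hom x y″)

  square-id : ∀ {x y} (f : x ⇒ y) → f ∘ id ≈ id ∘ f
  square-id f = Equiv.trans (identityʳ f) (Equiv.sym (identityˡ f))

  ObjClasses : Setoid o (ℓ ⊔ e)
  ObjClasses = record
    { Carrier       = Obj
    ; _≈_           = _≅_
    ; isEquivalence = record { refl = ≅-refl ; sym = ≅-sym ; trans = ≅-trans }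
    }

  record Morphism : Set (o ⊔ ℓ) where
    constructor morphism
    field
      {dom cod} : Obj
      arr       : dom ⇒ cod

  record _≅ₘ_ (f g : Morphism) : Set (ℓ ⊔ e) where
    private
      module f = Morphism f
      module g = Morphism g
    field
      α      : f.dom ≅ g.dom
      β      : f.cod ≅ g.cod
      square : g.arr ∘ _≅_.to α ≈ _≅_.to β ∘ f.arr

  MorphismClasses : Setoid (o ⊔ ℓ) (ℓ ⊔ e)
  MorphismClasses = record
    { Carrier       = Morphism
    ; _≈_           = _≅ₘ_
    ; isEquivalence = record
      { refl  = record { α = ≅-refl ; β = ≅-refl ; square = square-id _ }
      ; sym   = λ p → record
        { α      = ≅-sym (α p)
        ; β      = ≅-sym (β p)
        ; square = square-sym (α p) (β p) (square p)
        }
      ; trans = λ p q → record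
        { α      = ≅-trans (α p) (α q)
        ; β      = ≅-trans (β p) (β q)
        ; square = square-trans (square p) (square q)
        }
      }
    }
    where open _≅ₘ_

record Groupoid (o ℓ e : Level) : Set (lsuc (o ⊔ ℓ ⊔ e)) where
  field
    category : Category o ℓ e
  open Category category public
  field
    allIso : ∀ {x y} (f : x ⇒ y) → IsIso f

FullSubgroupoid : (G : Groupoid o ℓ e) → (Groupoid.Obj G → Set p) →
                  Groupoid (o ⊔ p) ℓ e
FullSubgroupoid G P = record
  { category = record
    { Obj       = Σ Obj P
    ; _⇒_       = λ x y → proj₁ x ⇒ proj₁ y
    ; _≈_       = _≈_
    ; id        = id
    ; _∘_       = _∘_
    ; equiv     = equiv
    ; assoc     = assoc
    ; identityˡ = identityˡ
    ; identityʳ = identityʳ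
    ; ∘-resp-≈  = ∘-resp-≈
    }
  ; allIso = λ f → record
    { inv  = IsIso.inv (allIso f)
    ; isoˡ = IsIso.isoˡ (allIso f)
    ; isoʳ = IsIso.isoʳ (allIso f)
    }
  }
  where open Groupoid G

module _ (G : ℕ → Groupoid o ℓ e) where
  private module G n = Groupoid (G n)

  ⨆Obj : Set o
  ⨆Obj = Σ ℕ G.Obj

  data ⨆Hom : ⨆Obj → ⨆Obj → Set (o ⊔ ℓ) where
    inn : ∀ {n x y} → G._⇒_ n x y → ⨆Hom (n , x) (n , y)

  data ⨆Eq : ∀ {X Y} → ⨆Hom X Y → ⨆Hom X Y → Set (o ⊔ ℓ ⊔ e) where
    inn : ∀ {n x y} {f g : G._⇒_ n x y} → G._≈_ n f g → ⨆Eq (inn f) (inn g)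

  private
    ⨆id : ∀ {X} → ⨆Hom X X
    ⨆id {n , _} = inn (G.id n)

    ⨆comp : ∀ {X Y Z} → ⨆Hom Y Z → ⨆Hom X Y → ⨆Hom X Z
    ⨆comp (inn g) (inn f) = inn (G._∘_ _ g f)

    ⨆refl : ∀ {X Y} {f : ⨆Hom X Y} → ⨆Eq f f
    ⨆refl {f = inn f} = inn (G.Equiv.refl _)

    ⨆sym : ∀ {X Y} {f g : ⨆Hom X Y} → ⨆Eq f g → ⨆Eq g f
    ⨆sym (inn p) = inn (G.Equiv.sym _ p)

    ⨆trans : ∀ {X Y} {f g h : ⨆Hom X Y} → ⨆Eq f g → ⨆Eq g h → ⨆Eq f h
    ⨆trans (inn p) (inn q) = inn (G.Equiv.trans _ p q)

    ⨆assoc : ∀ {W X Y Z} (f : ⨆Hom W X) (g : ⨆Hom X Y) (h : ⨆Hom Y Z) →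
             ⨆Eq (⨆comp (⨆comp h g) f) (⨆comp h (⨆comp g f))
    ⨆assoc (inn f) (inn g) (inn h) = inn (G.assoc _ f g h)

    ⨆identityˡ : ∀ {X Y} (f : ⨆Hom X Y) → ⨆Eq (⨆comp ⨆id f) f
    ⨆identityˡ (inn f) = inn (G.identityˡ _ f)

    ⨆identityʳ : ∀ {X Y} (f : ⨆Hom X Y) → ⨆Eq (⨆comp f ⨆id) f
    ⨆identityʳ (inn f) = inn (G.identityʳ _ f)

    ⨆resp : ∀ {X Y Z} {f f′ : ⨆Hom Y Z} {g g′ : ⨆Hom X Y} →
            ⨆Eq f f′ → ⨆Eq g g′ → ⨆Eq (⨆comp f g) (⨆comp f′ g′)
    ⨆resp (inn p) (inn q) = inn (G.∘-resp-≈ _ p q)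

    ⨆category : Category o (o ⊔ ℓ) (o ⊔ ℓ ⊔ e)
    ⨆category = record
      { Obj       = ⨆Obj
      ; _⇒_       = ⨆Hom
      ; _≈_       = ⨆Eq
      ; id        = ⨆id
      ; _∘_       = ⨆comp
      ; equiv     = record { refl = ⨆refl ; sym = ⨆sym ; trans = ⨆trans }
      ; assoc     = ⨆assoc
      ; identityˡ = ⨆identityˡ
      ; identityʳ = ⨆identityʳ
      ; ∘-resp-≈  = ⨆resp
      }

    ⨆allIso : ∀ {X Y} (f : ⨆Hom X Y) → Category.IsIso ⨆category f
    ⨆allIso (inn {n} f) = record
      { inv  = inn (G.IsIso.inv f⁻¹)
      ; isoˡ = inn (G.IsIso.isoˡ f⁻¹)
      ; isoʳ = inn (G.IsIso.isoʳ f⁻¹)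
      }
      where f⁻¹ = G.allIso n f

  ⨆ : Groupoid o (o ⊔ ℓ) (o ⊔ ℓ ⊔ e)
  ⨆ = record { category = ⨆category ; allIso = ⨆allIso }

module _ (C : Category o ℓ e) where
  open Category C

  -- x₀ → x₁ → ⋯ → xₙ, with mor i the morphism from xᵢ to xᵢ₊₁ (so the i-th
  -- entry fᵢ of the tuple (f₁,…,fₙ) is mor (i-1)).
  record Chain (n : ℕ) : Set (o ⊔ ℓ) where
    field
      obj : Fin (ℕ.suc n) → Obj
      mor : ∀ i → obj (inject₁ i) ⇒ obj (suc i)

  tail : ∀ {n} → Chain (ℕ.suc n) → Chain n
  tail c = record { obj = obj ∘′ suc ; mor = λ i → mor (suc i) }
    where open Chain c

  composite : ∀ {n} (c : Chain n) → Chain.obj c zero ⇒ Chain.obj c (fromℕ n)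
  composite {ℕ.zero}  c = id
  composite {ℕ.suc n} c = composite (tail c) ∘ Chain.mor c zero

  -- The condition on the composite only depends on the isomorphism class of f.
  -- The witnesses α, β play no role in the morphisms of D.
  record Decomposition (n : ℕ) (f : Morphism) : Set (o ⊔ ℓ ⊔ e) where
    private module f = Morphism f
    field
      chain : Chain n
    open Chain chain public
    field
      α  : obj zero ≅ f.dom
      β  : obj (fromℕ n) ≅ f.cod
      eq : composite chain ≈ _≅_.from β ∘ (f.arr ∘ _≅_.to α)

  record DecompositionHom {n f} (c d : Decomposition n f) : Set (ℓ ⊔ e) where
    private
      module c = Decomposition c
      module d = Decomposition d
    field
      vert   : ∀ i → c.obj i ≅ d.obj i
      square : ∀ i → d.mor i ∘ _≅_.to (vert (inject₁ i)) ≈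
                     _≅_.to (vert (suc i)) ∘ c.mor i

  D : ℕ → Morphism → Groupoid (o ⊔ ℓ ⊔ e) (ℓ ⊔ e) e
  D n f = record
    { category = record
      { Obj       = Decomposition n f
      ; _⇒_       = DecompositionHom
      ; _≈_       = λ φ ψ → ∀ i → to (vert φ i) ≈ to (vert ψ i)
      ; id        = record { vert = λ _ → ≅-refl ; square = λ _ → square-id _ }
      ; _∘_       = λ ψ φ → record
        { vert   = λ i → ≅-trans (vert φ i) (vert ψ i)
        ; square = λ i → square-trans (square φ i) (square ψ i)
        }
      ; equiv     = record
        { refl  = λ _ → Equiv.refl
        ; sym   = λ p i → Equiv.sym (p i)
        ; trans = λ p q i → Equiv.trans (p i) (q i)
        }
      ; assoc     = λ _ _ _ _ → assoc _ _ _
      ; identityˡ = λ _ _ → identityˡ _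
      ; identityʳ = λ _ _ → identityʳ _
      ; ∘-resp-≈  = λ p q i → ∘-resp-≈ (p i) (q i)
      }
    ; allIso = λ φ → record
      { inv  = record
        { vert   = λ i → ≅-sym (vert φ i)
        ; square = λ i → square-sym (vert φ (inject₁ i)) (vert φ (suc i)) (square φ i)
        }
      ; isoˡ = λ i → isoˡ (vert φ i)
      ; isoʳ = λ i → isoʳ (vert φ i)
      }
    }
    where
    open DecompositionHom
    open _≅_

  Proper : ∀ {n f} → Decomposition n f → Set (ℓ ⊔ e)
  Proper c = ∀ i → ¬ IsIso (Decomposition.mor c i)

  -- Lengths n ≥ 1 are encoded by their predecessors: PD₁₊ k is the groupoid of
  -- proper decompositions of length k + 1.
  PD₁₊ : ℕ → Morphism → Groupoid (o ⊔ ℓ ⊔ e) (ℓ ⊔ e) e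
  PD₁₊ ℕ.zero    f = D 1 f
  PD₁₊ (ℕ.suc k) f = FullSubgroupoid (D (ℕ.suc (ℕ.suc k)) f) Proper

  PD : Morphism → Groupoid (o ⊔ ℓ ⊔ e) (o ⊔ ℓ ⊔ e) (o ⊔ ℓ ⊔ e)
  PD f = ⨆ (λ k → PD₁₊ k f)

  FiniteHoms : Set (o ⊔ ℓ ⊔ e)
  FiniteHoms = ∀ x y → Finite (Hom x y)

  EssentiallyFiniteDecomposition : Set (o ⊔ ℓ ⊔ e)
  EssentiallyFiniteDecomposition =
    (f : Setoid.Carrier MorphismClasses) → Finite (Groupoid.ObjClasses (PD f))

  Isocyclic : Set (o ⊔ ℓ ⊔ e)
  Isocyclic = ∀ {x y} (f : x ⇒ y) (g : y ⇒ x) → IsIso f × IsIso g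

  -- Isomorphism classes of objects z admitting some x → z → y: the equality
  -- compares only the objects z.
  Between : Obj → Obj → Setoid (o ⊔ ℓ) (ℓ ⊔ e)
  Between x y = On.setoid {B = Σ Obj λ z → x ⇒ z × z ⇒ y} ObjClasses proj₁

  record EssentiallyLocallyFinite : Set (o ⊔ ℓ ⊔ e) where
    field
      finiteHoms    : FiniteHoms
      antisymmetric : ∀ {x y} → x ⇒ y → y ⇒ x → x ≅ y
      finiteBetween : ∀ x y → Finite (Between x y)

-- With finite hom-sets, invertibility and all isomorphism relations are decidable.
--
-- If decompositions are finite and h is an endomorphism, finiteness of the monoid
-- gives hᵃ⁺ᵖ ≈ hᵃ with p ≥ 1; were h not invertible, (h,…,h) would be a proper
-- decomposition of hᵃ of each length a + kp. So all endomorphisms are invertible,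
-- hence so are both morphisms of any x → y → x. An object z in x → z → y is
-- isomorphic to x, to y, or to the middle of a proper decomposition of x → y.
--
-- Conversely, in an isocyclic category the objects of a proper decomposition are
-- pairwise non-isomorphic, since xᵢ ≅ xⱼ with i < j puts xᵢ → xᵢ₊₁ on a cycle.
-- So the number of classes between x and y bounds the length, and a decomposition
-- is isomorphic to one through chosen representatives.
module Submission where

open import Defs
open import Level using (Level; _⊔_)
open import Data.Nat.Base as ℕ using (ℕ; zero; suc; z≤n; s≤s; _+_; _*_)
import Data.Nat.Properties as ℕ
open import Data.Fin.Base as Fin using (Fin; zero; suc; inject₁; fromℕ; toℕ)
import Data.Fin.Properties as Fin
open import Data.List.Base
  using (List; []; _∷_; [_]; _++_; lookup; map; tabulate; concatMap; fromMaybe;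
         upTo; deduplicate; cartesianProductWith)
open import Data.List.Membership.Setoid.Properties
  using (∈-cartesianProductWith⁺)
open import Data.List.Membership.Propositional.Properties using (∈-upTo⁺; ∈-lookup)
import Data.List.Relation.Unary.All as All
open import Data.List.Relation.Unary.AllPairs using (_∷_)
open import Data.List.Relation.Unary.Any as Any using (Any; here; there)
import Data.List.Relation.Unary.Any.Properties as Any
open import Data.List.Relation.Unary.Enumerates.Setoid using (IsEnumeration)
import Data.List.Relation.Unary.Enumerates.Setoid.Properties as Enumerates
import Data.List.Relation.Unary.Unique.Setoid as Unique
open import Data.List.Relation.Unary.Unique.DecSetoid.Properties
  using (deduplicate-!)
open import Data.Product.Base using (∃; ∃₂; _×_; _,_; proj₁; proj₂)
open import Data.Unit.Base using (⊤; tt)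
open import Function.Base using (_∘′_)
open import Function.Bundles using (_⇔_; mk⇔; Inverse; Injection)
import Function.Construct.Symmetry as Symmetry
open import Function.Properties.Inverse using (Inverse⇒Injection)
open import Relation.Binary.Bundles using (Setoid; DecSetoid)
open import Relation.Binary.Definitions using (Decidable; _Respects_)
import Relation.Binary.Construct.On as On
open import Relation.Binary.PropositionalEquality as ≡ using (_≡_; refl)
import Relation.Binary.Reasoning.Setoid as SetoidReasoning
open import Relation.Nullary.Decidable
  using (Dec; yes; no; dec⇒maybe; map′; _×-dec_; ¬?; decidable-stable; via-injection)
open import Relation.Nullary.Negation using (contradiction)
import Relation.Unary as U

private
  variable
    a b o ℓ e p q : Level
    m n : ℕ

-- Finite setoids

-- Repetitions are allowed, so lists can be built freely by products and concatenation;
-- `listable⇒finite` removes them at the end.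
Listable : Setoid a ℓ → Set (a ⊔ ℓ)
Listable S = ∃ (IsEnumeration S)

witnesses : {A : Set a} → Dec A → List A
witnesses a? = fromMaybe (dec⇒maybe a?)

-- `P` is required of every element because the decision may return a witness other than the given
-- one.
any-witnesses : {A : Set a} {P : U.Pred A p} (a? : Dec A) → A → (∀ x → P x) →
                Any P (witnesses a?)
any-witnesses (yes x) _ Px = here (Px x)
any-witnesses (no ¬x) x _  = contradiction x ¬x

any-concatMap : {A : Set a} {B : Set b} {P : U.Pred A p} {Q : U.Pred B q}
                (f : A → List B) {xs : List A} →
                Any P xs → (∀ {x} → P x → Any Q (f x)) → Any Q (concatMap f xs)
any-concatMap f Pxs Q = Any.concatMap⁺ f (Any.map Q Pxs)

module _ {S : Setoid a ℓ} where
  open Setoid S hiding (refl) renaming (Carrier to A)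

  finite⇒injection : (fin : Finite S) → Injection S (≡.setoid (Fin (proj₁ fin)))
  finite⇒injection (_ , inv) = Inverse⇒Injection (Symmetry.inverse inv)

  finite⇒decidable : Finite S → Decidable _≈_
  finite⇒decidable fin = via-injection (finite⇒injection fin) Fin._≟_

  finite⇒listable : Finite S → Listable S
  finite⇒listable (_ , inv) =
    tabulate to , λ x → Any.tabulate⁺ (from x) (sym (strictlyInverseˡ x))
    where open Inverse inv

  collision : (fin : Finite S) → proj₁ fin ℕ.< m → (g : Fin m → A) →
              ∃₂ λ i j → i Fin.< j × g i ≈ g j
  collision fin n<m g =
    let i , j , i<j , eq = Fin.pigeonhole n<m (Injection.to φ ∘′ g)
    in  i , j , i<j , Injection.injective φ eq
    where φ = finite⇒injection fin

  sequence-repeats : Finite S → (g : ℕ → A) → ∃₂ λ i j → i ℕ.< j × g i ≈ g j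
  sequence-repeats fin g =
    let i , j , i<j , eq = collision fin (ℕ.n<1+n _) (g ∘′ toℕ)
    in  toℕ i , toℕ j , i<j , eq

  lookup-injective : ∀ {xs} → Unique.Unique S xs → ∀ i j →
                     lookup xs i ≈ lookup xs j → i ≡ j
  lookup-injective (_ ∷ _)     zero    zero    _  = refl
  lookup-injective (x∉xs ∷ _)  zero    (suc j) eq =
    contradiction eq (All.lookup x∉xs (∈-lookup j))
  lookup-injective (x∉xs ∷ _)  (suc i) zero    eq =
    contradiction (sym eq) (All.lookup x∉xs (∈-lookup i))
  lookup-injective (_ ∷ xs!)   (suc i) (suc j) eq =
    ≡.cong suc (lookup-injective xs! i j eq)

  -- Deduplication leaves one representative per class, and the inverse bijection sends an element
  -- to the index of its representative.
  listable⇒finite : Listable S → Decidable _≈_ → Finite S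
  listable⇒finite (xs , enum) _≟_ = _ , record
    { to        = lookup ys
    ; from      = from
    ; to-cong   = λ where refl → Setoid.refl S
    ; from-cong = λ x≈y → injective (trans (sym (to-from _)) (trans x≈y (to-from _)))
    ; inverse   = (λ where refl → sym (to-from _))
                , (λ x≈ → injective (trans (sym (to-from _)) x≈))
    }
    where
    DS : DecSetoid a ℓ
    DS = record { isDecEquivalence = record { isEquivalence = isEquivalence ; _≟_ = _≟_ } }

    ys = deduplicate _≟_ xs

    enum′ : IsEnumeration S ys
    enum′ = Enumerates.deduplicate⁺ DS enum

    from : A → Fin _
    from x = Any.index (enum′ x)

    to-from : ∀ x → x ≈ lookup ys (from x)
    to-from x = Any.lookup-index (enum′ x)

    injective : ∀ {i j} → lookup ys i ≈ lookup ys j → i ≡ j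
    injective = lookup-injective (deduplicate-! DS xs) _ _

search : (S : Setoid a ℓ) {P : U.Pred (Setoid.Carrier S) p} → Listable S →
         P Respects (Setoid._≈_ S) → U.Decidable P → Dec (∃ P)
search S (xs , enum) resp P? = map′ Any.satisfied
  (λ (x , Px) → Any.map (λ x≈y → resp x≈y Px) (enum x))
  (Any.any? P? xs)

Π-setoid : (Fin n → Setoid a ℓ) → Setoid a ℓ
Π-setoid S = record
  { Carrier       = ∀ i → Setoid.Carrier (S i)
  ; _≈_           = λ f g → ∀ i → Setoid._≈_ (S i) (f i) (g i)
  ; isEquivalence = record
    { refl  = λ i → Setoid.refl (S i)
    ; sym   = λ p i → Setoid.sym (S i) (p i)
    ; trans = λ p q i → Setoid.trans (S i) (p i) (q i)
    }
  }

Π-listable : (S : Fin n → Setoid a ℓ) → (∀ i → Listable (S i)) → Listable (Π-setoid S)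
-- All functions out of `Fin zero` are pointwise equal, so a single entry lists them.
Π-listable {zero}  S list = [ (λ ()) ] , λ _ → here λ ()
Π-listable {suc n} {a} S list =
  cartesianProductWith cons xs fs , λ f → Any.map (λ eq → λ where
      zero → eq zero
      (suc i) → eq (suc i))
    (∈-cartesianProductWith⁺ (S zero) (Π-setoid (S ∘′ suc)) (Π-setoid S)
      (λ x≈ f≈ → λ where
        zero → x≈
        (suc i) → f≈ i)
      (x∈ (f zero)) (f∈ λ i → f (suc i)))
  where
  A : Fin (suc n) → Set a
  A i = Setoid.Carrier (S i)
  cons : A zero → (∀ i → A (suc i)) → ∀ i → A i
  cons = Fin.∀-cons {P = A}
  xs = proj₁ (list zero)
  x∈ = proj₂ (list zero)
  fs = proj₁ (Π-listable (S ∘′ suc) λ i → list (suc i))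
  f∈ = proj₂ (Π-listable (S ∘′ suc) λ i → list (suc i))

-- Coproducts of groupoids

groupoid-≅ : (G : Groupoid o ℓ e) → let open Groupoid G in ∀ {x y} → x ⇒ y → x ≅ y
groupoid-≅ G f = record { to = f ; isIso = Groupoid.allIso G f }

module _ (G : ℕ → Groupoid o ℓ e) where
  private
    module G n = Groupoid (G n)
    module ⨆G = Groupoid (⨆ G)

  ⨆-≅-index : ∀ {X Y} → X ⨆G.≅ Y → proj₁ X ≡ proj₁ Y
  ⨆-≅-index X≅Y with inn _ ← ⨆G._≅_.to X≅Y = refl

  ⨆-≅⇒hom : ∀ {n x y} → (n , x) ⨆G.≅ (n , y) → G._⇒_ n x y
  ⨆-≅⇒hom X≅Y with inn f ← ⨆G._≅_.to X≅Y = f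

  ⨆-hom⇒≅ : ∀ {n x y} → G._⇒_ n x y → (n , x) ⨆G.≅ (n , y)
  ⨆-hom⇒≅ f = groupoid-≅ (⨆ G) (inn f)

  ⨆-≅? : (∀ n x y → Dec (G._⇒_ n x y)) → Decidable ⨆G._≅_
  ⨆-≅? hom? (m , x) (n , y) with m ℕ.≟ n
  ... | no m≢n   = no λ X≅Y → m≢n (⨆-≅-index X≅Y)
  ... | yes refl = map′ ⨆-hom⇒≅ ⨆-≅⇒hom (hom? m x y)

  -- The hypothesis on `G.Obj` says that all levels from `m` on are empty, so finitely many lists
  -- exhaust the coproduct.
  ⨆-listable : ∀ m → (∀ n → G.Obj n → n ℕ.< m) →
               (∀ n → Listable (G.ObjClasses n)) → Listable ⨆G.ObjClasses
  ⨆-listable m bound list =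
    concatMap level (upTo m) , λ (n , x) →
      any-concatMap level (∈-upTo⁺ (bound n x)) λ where
        refl → Any.map⁺ (Any.map (λ x≅y → ⨆-hom⇒≅ (G._≅_.to x≅y)) (proj₂ (list n) x))
    where
    level : ℕ → List ⨆G.Obj
    level n = map (n ,_) (proj₁ (list n))

-- Chains and decompositions

module CategoryProperties (C : Category o ℓ e) where
  open Category C
  open _≅_ using (to; from; isIso)
  open _≅ₘ_ using (α; β)

  pull : ∀ {w x y z} {f : w ⇒ x} {g : x ⇒ y} {h : y ⇒ z} {k : w ⇒ y} →
         g ∘ f ≈ k → (h ∘ g) ∘ f ≈ h ∘ k
  pull gf≈k = Equiv.trans (assoc _ _ _) (∘-resp-≈ Equiv.refl gf≈k)

  cancelˡ : ∀ {x y z} {f : x ⇒ y} {g : y ⇒ z} {h : z ⇒ y} →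
            h ∘ g ≈ id → h ∘ (g ∘ f) ≈ f
  cancelˡ {f = f} hg≈id = Equiv.trans (Equiv.sym (assoc _ _ _))
    (Equiv.trans (∘-resp-≈ hg≈id Equiv.refl) (identityˡ f))

  IsIso-resp-≈ : ∀ {x y} {f g : x ⇒ y} → f ≈ g → IsIso f → IsIso g
  IsIso-resp-≈ f≈g f-iso = record
    { inv  = inv
    ; isoˡ = Equiv.trans (∘-resp-≈ Equiv.refl (Equiv.sym f≈g)) isoˡ
    ; isoʳ = Equiv.trans (∘-resp-≈ (Equiv.sym f≈g) Equiv.refl) isoʳ
    }
    where open IsIso f-iso

  inverses⇒IsIso : ∀ {x y} {f : x ⇒ y} {l r : y ⇒ x} →
                   l ∘ f ≈ id → f ∘ r ≈ id → IsIso f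
  inverses⇒IsIso {x} {y} {f} {l} {r} lf fr = record { inv = l ; isoˡ = lf ; isoʳ = fl }
    where
    l≈r : l ≈ r
    l≈r = begin
      l            ≈⟨ identityʳ l ⟨
      l ∘ id       ≈⟨ ∘-resp-≈ Equiv.refl fr ⟨
      l ∘ (f ∘ r)  ≈⟨ cancelˡ lf ⟩
      r            ∎
      where open SetoidReasoning (Hom y x)

    fl : f ∘ l ≈ id
    fl = Equiv.trans (∘-resp-≈ Equiv.refl l≈r) fr

  -- An inverse of `g ∘ f` yields a left inverse of `f` and a right inverse of `g`; an inverse of
  -- `f ∘ g` yields the other two. One-sided inverses on both sides agree.
  composites-IsIso : ∀ {x y} {f : x ⇒ y} {g : y ⇒ x} →
                     IsIso (g ∘ f) → IsIso (f ∘ g) → IsIso f × IsIso g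
  composites-IsIso gf-iso fg-iso =
      inverses⇒IsIso (left gf-iso) (right fg-iso)
    , inverses⇒IsIso (left fg-iso) (right gf-iso)
    where
    left : ∀ {x y} {f : x ⇒ y} {g : y ⇒ x} (i : IsIso (g ∘ f)) → (IsIso.inv i ∘ g) ∘ f ≈ id
    left i = Equiv.trans (assoc _ _ _) (IsIso.isoˡ i)

    right : ∀ {x y} {f : x ⇒ y} {g : y ⇒ x} (i : IsIso (f ∘ g)) → f ∘ (g ∘ IsIso.inv i) ≈ id
    right i = Equiv.trans (Equiv.sym (assoc _ _ _)) (IsIso.isoʳ i)

  IsIso-square : ∀ {x y z w} {f : x ⇒ y} {g : z ⇒ w} (φ : x ≅ z) (ψ : y ≅ w) →
                 g ∘ to φ ≈ to ψ ∘ f → IsIso g → IsIso f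
  IsIso-square {f = f} {g} φ ψ sq g-iso = IsIso-resp-≈ eq
    (isIso (≅-trans (≅-trans φ (record { to = g ; isIso = g-iso })) (≅-sym ψ)))
    where
    eq : from ψ ∘ (g ∘ to φ) ≈ f
    eq = Equiv.trans (∘-resp-≈ Equiv.refl sq) (cancelˡ (_≅_.isoˡ ψ))

  ≈⇒≅ₘ : ∀ {x y} {f g : x ⇒ y} → f ≈ g → morphism f ≅ₘ morphism g
  ≈⇒≅ₘ f≈g = record
    { α      = ≅-refl
    ; β      = ≅-refl
    ; square = Equiv.trans (square-id _) (∘-resp-≈ Equiv.refl (Equiv.sym f≈g))
    }

  open Chain using (obj; mor)

  path : (c : Chain C n) {i j : Fin (suc n)} → i Fin.≤ j → obj c i ⇒ obj c j
  path {_}     c {zero}  {zero}  _         = id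
  path {suc n} c {zero}  {suc j} _         = path (tail C c) {zero} {j} z≤n ∘ mor c zero
  path {suc n} c {suc i} {suc j} (s≤s i≤j) = path (tail C c) i≤j

  cycle⇒IsIso : Isocyclic C → (c : Chain C n) {i j : Fin (suc n)} → i Fin.< j →
                obj c j ⇒ obj c i → ∃ λ k → IsIso (mor c k)
  -- The first arrow, followed by the path to `obj c (suc j)` and then by `r`, closes a cycle.
  cycle⇒IsIso {suc n} cyc c {zero}  {suc j} _         r =
    zero , proj₁ (cyc (mor c zero) (r ∘ path (tail C c) {zero} {j} z≤n))
  cycle⇒IsIso {suc n} cyc c {suc i} {suc j} (s≤s i<j) r =
    let k , k-iso = cycle⇒IsIso cyc (tail C c) i<j r in suc k , k-iso

  passesThrough : ∀ {f} (c : Decomposition C n f) i →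
                  Morphism.dom f ⇒ Decomposition.obj c i × Decomposition.obj c i ⇒ Morphism.cod f
  passesThrough c i =
      path c.chain {zero} {i} z≤n ∘ from c.α
    , to c.β ∘ path c.chain (Fin.≤fromℕ i)
    where module c = Decomposition c

  -- The data of a `DecompositionHom` without reference to `f`: chains are listed up to this
  -- relation before those decomposing `f` are selected.
  record _≅c_ (c d : Chain C n) : Set (ℓ ⊔ e) where
    field
      vert   : ∀ i → obj c i ≅ obj d i
      square : ∀ i → mor d i ∘ to (vert (inject₁ i)) ≈ to (vert (suc i)) ∘ mor c i

  composite-natural : (c d : Chain C n) (v : ∀ i → obj c i ⇒ obj d i) →
                      (∀ i → mor d i ∘ v (inject₁ i) ≈ v (suc i) ∘ mor c i) →
                      composite C d ∘ v zero ≈ v (fromℕ n) ∘ composite C c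
  composite-natural {zero}  c d v sq = Equiv.sym (square-id _)
  composite-natural {suc n} c d v sq = Equiv.sym (square-trans (Equiv.sym (sq zero))
    (Equiv.sym (composite-natural (tail C c) (tail C d) (λ i → v (suc i)) (λ i → sq (suc i)))))

  composite-≅ₘ : {c d : Chain C n} → c ≅c d →
                 morphism (composite C c) ≅ₘ morphism (composite C d)
  composite-≅ₘ {c = c} {d} c≅d = record
    { α      = vert zero
    ; β      = vert (fromℕ _)
    ; square = composite-natural c d (λ i → to (vert i)) square
    }
    where open _≅c_ c≅d

  -- Together with `decomposition-≅ₘ`, this reads the condition on a decomposition as an isomorphism
  -- from the composite to `f`, a decidable relation when hom-sets are finite.
  decomposition : ∀ {f} (c : Chain C n) → morphism (composite C c) ≅ₘ f → Decomposition C n f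
  decomposition c c≅f = record
    { chain = c
    ; α     = α c≅f
    ; β     = β c≅f
    ; eq    = Equiv.sym (Equiv.trans (∘-resp-≈ Equiv.refl (_≅ₘ_.square c≅f))
                          (cancelˡ (_≅_.isoˡ (β c≅f))))
    }

  decomposition-≅ₘ : ∀ {f} (c : Decomposition C n f) →
                     morphism (composite C (Decomposition.chain c)) ≅ₘ f
  decomposition-≅ₘ c = record
    { α      = Decomposition.α c
    ; β      = Decomposition.β c
    ; square = Equiv.sym (Equiv.trans (∘-resp-≈ Equiv.refl (Decomposition.eq c))
                           (cancelˡ (_≅_.isoʳ (Decomposition.β c))))
    }

  module _ {f : Morphism} {c d : Decomposition C n f} where
    private
      module c = Decomposition c
      module d = Decomposition d

    ≅c⇒hom : c.chain ≅c d.chain → DecompositionHom C c d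
    ≅c⇒hom c≅d = record { vert = vert ; square = square }
      where open _≅c_ c≅d

    Proper-resp : DecompositionHom C c d → Proper C c → Proper C d
    Proper-resp φ c-proper i di-iso =
      c-proper i (IsIso-square (vert (inject₁ i)) (vert (suc i)) (square i) di-iso)
      where open DecompositionHom φ

-- Categories with finite hom-sets

module FiniteHomProperties (C : Category o ℓ e) (finiteHoms : FiniteHoms C) where
  open Category C
  open CategoryProperties C
  open _≅_ using (to; from; isIso)
  open Chain using (obj; mor)

  _≈?_ : ∀ {x y} → Decidable (_≈_ {x} {y})
  _≈?_ = finite⇒decidable (finiteHoms _ _)

  homs : ∀ x y → Listable (Hom x y)
  homs x y = finite⇒listable (finiteHoms x y)

  isIso? : ∀ {x y} (f : x ⇒ y) → Dec (IsIso f)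
  isIso? f = map′
    (λ (g , gf≈id , fg≈id) → record { inv = g ; isoˡ = gf≈id ; isoʳ = fg≈id })
    (λ i → IsIso.inv i , IsIso.isoˡ i , IsIso.isoʳ i)
    (search (Hom _ _) (homs _ _)
      (λ g≈g′ (gf≈id , fg≈id) →
          Equiv.trans (∘-resp-≈ (Equiv.sym g≈g′) Equiv.refl) gf≈id
        , Equiv.trans (∘-resp-≈ Equiv.refl (Equiv.sym g≈g′)) fg≈id)
      (λ g → (g ∘ f) ≈? id ×-dec (f ∘ g) ≈? id))

  -- Comparing underlying morphisms is enough, since these determine their inverses up to `_≈_`.
  Isos : Obj → Obj → Setoid (ℓ ⊔ e) e
  Isos x y = On.setoid {B = x ≅ y} (Hom x y) to

  isos : ∀ x y → Listable (Isos x y)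
  isos x y = concatMap list (proj₁ (homs x y)) , λ φ →
    any-concatMap list (proj₂ (homs x y) (to φ)) λ {f} φ≈f →
      Any.map⁺ (any-witnesses (isIso? f) (IsIso-resp-≈ φ≈f (isIso φ)) (λ _ → φ≈f))
    where
    list : x ⇒ y → List (x ≅ y)
    list f = map (λ f-iso → record { to = f ; isIso = f-iso }) (witnesses (isIso? f))

  _≅?_ : Decidable _≅_
  x ≅? y = map′ proj₁ (_, tt) (search (Isos x y) (isos x y) (λ _ _ → tt) (λ _ → yes tt))

  _≅ₘ?_ : Decidable _≅ₘ_
  f ≅ₘ? g = map′
    (λ (α , β , sq) → record { α = α ; β = β ; square = sq })
    (λ f≅g → let open _≅ₘ_ f≅g in α , β , square)
    (search (Isos _ _) (isos _ _)
      (λ α≈ (β , sq) →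
        β , Equiv.trans (∘-resp-≈ Equiv.refl (Equiv.sym α≈)) sq)
      (λ α → search (Isos _ _) (isos _ _)
        (λ β≈ sq → Equiv.trans sq (∘-resp-≈ β≈ Equiv.refl))
        (λ β → (Morphism.arr g ∘ to α) ≈? (to β ∘ Morphism.arr f))))

  hom? : ∀ {f} (c d : Decomposition C n f) → Dec (DecompositionHom C c d)
  hom? c d = map′
    (λ (v , sq) → record { vert = v ; square = sq })
    (λ φ → let open DecompositionHom φ in vert , square)
    (search (Π-setoid Is) (Π-listable Is (λ i → isos (c.obj i) (d.obj i)))
      (λ v≈ sq i → Equiv.trans (∘-resp-≈ Equiv.refl (Equiv.sym (v≈ (inject₁ i))))
                     (Equiv.trans (sq i) (∘-resp-≈ (v≈ (suc i)) Equiv.refl)))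
      (λ v → Fin.all? λ i → (d.mor i ∘ to (v (inject₁ i))) ≈? (to (v (suc i)) ∘ c.mor i)))
    where
    module c = Decomposition c
    module d = Decomposition d

    Is : Fin (suc _) → Setoid (ℓ ⊔ e) e
    Is i = Isos (c.obj i) (d.obj i)

  proper? : ∀ {f} (c : Decomposition C n f) → Dec (Proper C c)
  proper? c = Fin.all? λ i → ¬? (isIso? (Decomposition.mor c i))

  PD-hom? : ∀ k f (X Y : Groupoid.Obj (PD₁₊ C k f)) → Dec (Groupoid._⇒_ (PD₁₊ C k f) X Y)
  PD-hom? zero    f c       d       = hom? c d
  PD-hom? (suc k) f (c , _) (d , _) = hom? c d

  PD-≅? : ∀ f → Decidable (Groupoid._≅_ (PD C f))
  PD-≅? f = ⨆-≅? (λ k → PD₁₊ C k f) (λ k → PD-hom? k f)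

  -- Listing and bounding decompositions

  module _ (finiteBetween : ∀ x y → Finite (Between C x y)) where

    between : ∀ x y → Listable (Between C x y)
    between x y = finite⇒listable (finiteBetween x y)

    module _ (x y : Obj) (n : ℕ) where

      Betweens : Setoid (o ⊔ ℓ) (ℓ ⊔ e)
      Betweens = Π-setoid {suc n} λ _ → Between C x y

      chainsThrough : Setoid.Carrier Betweens → List (Chain C n)
      chainsThrough z = map (λ m → record { obj = λ i → proj₁ (z i) ; mor = m })
        (proj₁ (Π-listable (λ i → Hom (proj₁ (z (inject₁ i))) (proj₁ (z (suc i)))) λ i → homs _ _))

      betweens : Listable Betweens
      betweens = Π-listable (λ _ → Between C x y) λ _ → between x y

      chains : List (Chain C n)
      chains = concatMap chainsThrough (proj₁ betweens)

      -- Each object is replaced by its listed representative through an isomorphism `v i`, and each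
      -- arrow is conjugated by these; the conjugated family of arrows is listed because hom-sets
      -- are.
      chains-complete : (c : Chain C n) → (∀ i → x ⇒ obj c i × obj c i ⇒ y) →
                        Any (c ≅c_) chains
      chains-complete c via =
        any-concatMap chainsThrough (proj₂ betweens (λ i → obj c i , via i)) λ v →
          Any.map⁺ (Any.map
            (λ m≈ → record
              { vert   = v
              ; square = λ i → Equiv.trans (∘-resp-≈ (Equiv.sym (m≈ i)) Equiv.refl)
                  (Equiv.trans (pull (_≅_.isoˡ (v (inject₁ i))))
                    (identityʳ _))
              })
            (proj₂ (Π-listable _ λ i → homs _ _)
              (λ i → (to (v (suc i)) ∘ mor c i) ∘ from (v (inject₁ i)))))

    decompositions : ∀ {n f} {P : U.Pred (Decomposition C n f) p} →
                     (∀ {c d} → DecompositionHom C c d → P c → P d) → U.Decidable P →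
                     Listable (Groupoid.ObjClasses (FullSubgroupoid (D C n f) P))
    decompositions {n = n} {f} {P} P-resp P? =
      concatMap onChain cs , λ (c , Pc) →
        any-concatMap onChain (chains-complete dom cod n (Decomposition.chain c) (passesThrough c))
          λ {d} c≅d → any-concatMap (onDecomposition d)
            -- The isomorphism to `f` found here may differ from the one induced by `c`; the
            -- resulting decomposition is still isomorphic to `c` through `c≅d`.
            (any-witnesses {P = λ _ → ⊤} (morphism (composite C d) ≅ₘ? f)
              (Setoid.trans MorphismClasses
                (Setoid.sym MorphismClasses (composite-≅ₘ c≅d)) (decomposition-≅ₘ c))
              _)
            λ {d≅f} _ → Any.map⁺ (any-witnesses (P? (decomposition d d≅f))
              (P-resp (≅c⇒hom c≅d) Pc)
              λ _ → groupoid-≅ (FullSubgroupoid (D C n f) P) (≅c⇒hom c≅d))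
      where
      open Morphism f
      cs = chains dom cod n

      onDecomposition : (d : Chain C n) → morphism (composite C d) ≅ₘ f → List (∃ P)
      onDecomposition d d≅f = map (_ ,_) (witnesses (P? (decomposition d d≅f)))

      onChain : Chain C n → List (∃ P)
      onChain d = concatMap (onDecomposition d) (witnesses (morphism (composite C d) ≅ₘ? f))

    PD₁₊-listable : ∀ k f → Listable (Groupoid.ObjClasses (PD₁₊ C k f))
    PD₁₊-listable zero f =
      -- The trivial predicate presents `D C 1 f` as a full subgroupoid of itself, so the general
      -- listing applies to length 1.
      let cs , c∈ = decompositions {P = λ _ → ⊤} _ (λ _ → yes tt)
      in  map proj₁ cs , λ c → Any.map⁺
            (Any.map (λ c≅d → groupoid-≅ (D C 1 f) (Category._≅_.to c≅d)) (c∈ (c , tt)))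
    PD₁₊-listable (suc k) f = decompositions Proper-resp proper?

    proper-length : Isocyclic C → ∀ {f} (c : Decomposition C n f) → Proper C c →
                    n ℕ.< proj₁ (finiteBetween (Morphism.dom f) (Morphism.cod f))
    proper-length cyc {f} c c-proper = ℕ.≰⇒> λ size≤n →
      -- A chain of length `n` has `n + 1` objects, more than the number of available classes.
      let i , j , i<j , xᵢ≅xⱼ = collision (finiteBetween _ _) (s≤s size≤n)
                                  (λ i → Decomposition.obj c i , passesThrough c i)
          k , k-iso = cycle⇒IsIso cyc (Decomposition.chain c) i<j (from xᵢ≅xⱼ)
      in  c-proper k k-iso

    isocyclic⇒finiteDecomposition : Isocyclic C → EssentiallyFiniteDecomposition C
    isocyclic⇒finiteDecomposition cyc f = listable⇒finite
      (⨆-listable (λ k → PD₁₊ C k f) (suc size) bound (λ k → PD₁₊-listable k f))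
      (PD-≅? f)
      where
      size = proj₁ (finiteBetween (Morphism.dom f) (Morphism.cod f))

      -- Level `k` holds length `k + 1`. Level zero has no properness condition to bound it, and
      -- taking `suc size` puts it below the bound at once.
      bound : ∀ k → Groupoid.Obj (PD₁₊ C k f) → k ℕ.< suc size
      bound zero    _              = s≤s z≤n
      bound (suc k) (c , c-proper) =
        ℕ.≤-trans (ℕ.n≤1+n _) (ℕ.m≤n⇒m≤1+n (proper-length cyc c c-proper))

  -- Powers of an endomorphism

  loop : ∀ {x} → x ⇒ x → ∀ n → Chain C n
  loop {x} h n = record { obj = λ _ → x ; mor = λ _ → h }

  module _ {x : Obj} (h : x ⇒ x) where
    -- As a composite of the loop, it has `loop h n` as a decomposition by construction, and
    -- `power (suc n)` unfolds to `power n ∘ h`.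
    power : ℕ → x ⇒ x
    power n = composite C (loop h n)

    -- Lengths start at 2: properness is only imposed from there on.
    power-shift : power (2 + m) ≈ power (2 + n) → ∀ k → power (2 + (k + m)) ≈ power (2 + (k + n))
    power-shift hᵐ≈hⁿ zero    = hᵐ≈hⁿ
    power-shift hᵐ≈hⁿ (suc k) = ∘-resp-≈ (power-shift hᵐ≈hⁿ k) Equiv.refl

    power-periodic : ∀ {a p} → power (2 + (a + p)) ≈ power (2 + a) →
                     ∀ k → power (2 + (k * p + a)) ≈ power (2 + a)
    power-periodic         _   zero    = Equiv.refl
    power-periodic {a} {p} per (suc k) = begin
      -- The exponent is regrouped as `k * p + (a + p)`, so that `per` shifted by `k * p` removes
      -- one period.
      power (2 + (p + k * p + a))    ≡⟨ ≡.cong (λ n → power (2 + (n + a))) (ℕ.+-comm p (k * p)) ⟩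
      power (2 + (k * p + p + a))    ≡⟨ ≡.cong (λ n → power (2 + n)) (ℕ.+-assoc (k * p) p a) ⟩
      power (2 + (k * p + (p + a)))  ≡⟨ ≡.cong (λ n → power (2 + (k * p + n))) (ℕ.+-comm p a) ⟩
      power (2 + (k * p + (a + p)))  ≈⟨ power-shift per (k * p) ⟩
      power (2 + (k * p + a))        ≈⟨ power-periodic per k ⟩
      power (2 + a)                  ∎
      where open SetoidReasoning (Hom x x)

    power-repeats : ∃₂ λ a q → power (2 + (a + suc q)) ≈ power (2 + a)
    power-repeats =
      let a , b , a<b , hᵃ≈hᵇ = sequence-repeats (finiteHoms x x) (λ n → power (2 + n))
          -- `a<b` unfolds to `suc a ≤ b`, so the gap between the exponents is `suc q`, a positive
          -- period.
          q , a+q≡b = ℕ.m≤n⇒∃[o]m+o≡n a<b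
      in  a , q , Equiv.sym (≡.subst (λ n → power (2 + a) ≈ power (2 + n))
                    (≡.trans (≡.sym a+q≡b) (≡.sym (ℕ.+-suc a q))) hᵃ≈hᵇ)

  -- Consequences of finite decomposition

  module _ (finite : EssentiallyFiniteDecomposition C) where

    endomorphism-IsIso : ∀ {x} (h : x ⇒ x) → IsIso h
    endomorphism-IsIso h = decidable-stable (isIso? h) λ ¬iso →
      let a , q , per = power-repeats h
          i , j , i<j , loopsᵢ≅loopsⱼ = sequence-repeats (finite (morphism (power h (2 + a)))) λ k →
              -- This level holds length `2 + (k * suc q + a)`, the exponent in `power-periodic`.
              suc (k * suc q + a)
            , decomposition (loop h _) (≈⇒≅ₘ (power-periodic h per k))
            , λ _ → ¬iso
          -- Isomorphic objects of the coproduct have equal lengths, and cancelling `a` and the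
          -- nonzero `suc q` gives `i ≡ j`.
          lengths≡ = ⨆-≅-index (λ k → PD₁₊ C k _) loopsᵢ≅loopsⱼ
      in  contradiction
            (ℕ.*-cancelʳ-≡ i j (suc q) (ℕ.+-cancelʳ-≡ a _ _ (ℕ.suc-injective lengths≡)))
            (ℕ.<⇒≢ i<j)

    isocyclic : Isocyclic C
    isocyclic f g = composites-IsIso (endomorphism-IsIso (g ∘ f)) (endomorphism-IsIso (f ∘ g))

    factorization : ∀ {x y z} → x ⇒ z → z ⇒ y → Chain C 2
    factorization {x} {y} {z} u v = record
      { obj = λ where
          zero             → x
          (suc zero)       → z
          (suc (suc zero)) → y
      ; mor = λ where
          zero       → u
          (suc zero) → v
      }

    module _ (x y : Obj) where
      private
        B = Setoid.Carrier (Between C x y)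
        module PD f = Groupoid (PD C (morphism {dom = x} {cod = y} f))

      endpoints : x ⇒ y → List B
      endpoints f = (x , id , f) ∷ (y , f , id) ∷ []

      -- Level `suc zero` holds the proper decompositions of length 2, the only ones with a single
      -- middle object to read off.
      middle : ∀ {f} → PD.Obj f → List B
      middle (suc zero , c , _) = [ Decomposition.obj c (suc zero) , passesThrough c (suc zero) ]
      middle _                  = []

      objectsThrough : x ⇒ y → List B
      objectsThrough f =
        endpoints f ++ concatMap middle (proj₁ (finite⇒listable (finite (morphism f))))

      -- Matching on `inn` forces `Y` to have length 2 as well, so that `middle Y` is nonempty.
      middle-resp : ∀ {f c c-proper Y} → PD._≅_ f (1 , c , c-proper) Y →
                    Any (λ b → Decomposition.obj c (suc zero) ≅ proj₁ b) (middle Y)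
      middle-resp X≅Y with inn φ ← Category._≅_.to X≅Y =
        here (DecompositionHom.vert φ (suc zero))

      objectsThrough-complete : ∀ {f z} (u : x ⇒ z) (v : z ⇒ y) → v ∘ u ≈ f →
                                Any (λ b → z ≅ proj₁ b) (objectsThrough f)
      objectsThrough-complete {f} u v vu≈f with isIso? u | isIso? v
      ... | yes u-iso | _         = here (≅-sym (record { to = u ; isIso = u-iso }))
      ... | no _      | yes v-iso = there (here (record { to = v ; isIso = v-iso }))
      ... | no ¬u-iso | no ¬v-iso = Any.++⁺ʳ (endpoints f)
        (any-concatMap middle (proj₂ (finite⇒listable (finite (morphism f))) X) middle-resp)
        where
        X : PD.Obj f
        X = 1
          , decomposition (factorization u v)
              -- The composite of the two-step chain unfolds to `(id ∘ v) ∘ u`.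
              (≈⇒≅ₘ (Equiv.trans (∘-resp-≈ (identityˡ v) Equiv.refl) vu≈f))
          , λ where
              zero       → ¬u-iso
              (suc zero) → ¬v-iso

      -- Every `x ⇒ z ⇒ y` composes to one of the finitely many listed morphisms `x ⇒ y`, so the
      -- objects are collected morphism by morphism.
      between-listable : Listable (Between C x y)
      between-listable = concatMap objectsThrough (proj₁ (homs x y)) , λ (z , u , v) →
        any-concatMap objectsThrough (proj₂ (homs x y) (v ∘ u)) (objectsThrough-complete u v)

    essentiallyLocallyFinite : EssentiallyLocallyFinite C
    essentiallyLocallyFinite = record
      { finiteHoms    = finiteHoms
      ; antisymmetric = λ f g → record { to = f ; isIso = proj₁ (isocyclic f g) }
      ; finiteBetween = λ x y →
          listable⇒finite (between-listable x y) (λ b b′ → proj₁ b ≅? proj₁ b′)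
      }

theorem8p1 : ∀ {o ℓ e} (C : Category o ℓ e) →
    FiniteHoms C →
    EssentiallyFiniteDecomposition C ⇔ (Isocyclic C × EssentiallyLocallyFinite C)
theorem8p1 C finiteHoms = mk⇔ forward backward
  where
  open FiniteHomProperties C finiteHoms

  forward : EssentiallyFiniteDecomposition C → Isocyclic C × EssentiallyLocallyFinite C
  forward finite = isocyclic finite , essentiallyLocallyFinite finite

  backward : Isocyclic C × EssentiallyLocallyFinite C → EssentiallyFiniteDecomposition C
  backward (cyc , elf) =
    isocyclic⇒finiteDecomposition (EssentiallyLocallyFinite.finiteBetween elf) cyc
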